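{- For all positive integers $n$ and $r$, $$\sum_{k=0}^{n-1}T_k^{(2r)}\equiv 0\pmod{n^2},$$ where for a nonnegative integer $m$ and positive integer $s$, $T_m^{(s)}=\sum_{k=0}^{m}\binom{m}{k}^2\binom{2k}{k}(2k+1)^{s}(-1)^k$. -}

module Defs where

open import Data.Nat using (ℕ; zero; suc)
import Data.Nat as ℕ
open import Data.Nat.Combinatorics using (_C_)
open import Data.Integer using (ℤ; +_; _+_; _*_; -_; _^_)

sumTo : ℕ → (ℕ → ℤ) → ℤ
sumTo zero    f = f 0
sumTo (suc m) f = sumTo m f + f (suc m)

sumBelow : ℕ → (ℕ → ℤ) → ℤ
sumBelow zero    f = + 0
sumBelow (suc n) f = sumBelow n f + f n

sign : ℕ → ℤ
sign k = (- (+ 1)) ^ k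

T : ℕ → ℕ → ℤ
T m s = sumTo m (λ k → + ((m C k) ℕ.^ 2 ℕ.* ((2 ℕ.* k) C k) ℕ.* (2 ℕ.* k ℕ.+ 1) ℕ.^ s) * sign k)

{-# OPTIONS --safe #-}
-- For h : ℕ → ℤ, Zeilberger's method yields
--   ∑_{m<n} ∑_{k≤m} C(m,k)² C(2k,k) (−1)ᵏ (2k+1) (k h(k) + (k+1) h(k+1)) = ∑_{k<n} X(n,k),
-- where X(n,k) = (−1)ᵏ h(k+1) (2k+1) C(2k,k) C(n,k+1)² (3(k+1) − 2n), and n² divides each X(n,k)
-- because n C(n−1,k) = (k+1) C(n,k+1) and k+1 divides C(2k,k).
-- It remains to write (2k+1)²ʳ⁻¹ as k h(k) + (k+1) h(k+1).  With e_i(k) = ∏_{1≤j≤i} (k+j)(k+1−j),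
-- the choice h(k) = ∏_{1≤j≤i} (k²−j²) represents (2k+1) e_i(k), and
-- (2k+1)² e_i = 4 e_{i+1} + (2i+1)² e_i, so all odd powers of 2k+1 are reached.
module Submission where

open import Defs
open import Data.Nat using (ℕ; zero; suc; NonZero)
import Data.Nat as ℕ
import Data.Nat.Properties as ℕ
open import Data.Nat.Combinatorics
  using (_C_; nCk≡nC[n∸k]; nCk+nC[k+1]≡[n+1]C[k+1]; k>n⇒nCk≡0; nC1≡n)
open import Data.Integer using (ℤ; +_; _+_; _*_; -_; _^_)
open import Data.Integer.Divisibility using (_∣_)
import Data.Integer.Divisibility.Signed as Signed
open import Data.Integer.Properties
open import Data.Integer.Tactic.RingSolver using (solve-∀)
open import Data.Product using (∃; _,_)
open import Relation.Binary.PropositionalEquality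
open ≡-Reasoning

-- The ring solver takes no hypotheses. An identity modulo a relation `x ≡ y` is therefore stated
-- with an explicit multiple of `x + - y` added, and that multiple is then discarded.
absorb-multiple : ∀ e {x y} r → x ≡ y → r + e * (x + - y) ≡ r
absorb-multiple e {x} r refl = lemma r e x
  where
  lemma : ∀ r e x → r + e * (x + - x) ≡ r
  lemma = solve-∀

pos-^ : ∀ a n → + (a ℕ.^ n) ≡ (+ a) ^ n
pos-^ a zero    = refl
pos-^ a (suc n) = trans (pos-* a (a ℕ.^ n)) (cong (+ a *_) (pos-^ a n))

-- Finite sums

sumTo≡sumBelow : ∀ m f → sumTo m f ≡ sumBelow (suc m) f
sumTo≡sumBelow zero    f = sym (+-identityˡ (f 0))
sumTo≡sumBelow (suc m) f = cong (_+ f (suc m)) (sumTo≡sumBelow m f)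

sumBelow-cong : ∀ n {f g : ℕ → ℤ} → (∀ k → f k ≡ g k) → sumBelow n f ≡ sumBelow n g
sumBelow-cong zero    f≗g = refl
sumBelow-cong (suc n) f≗g = cong₂ _+_ (sumBelow-cong n f≗g) (f≗g n)

sumBelow-+ : ∀ n f g → sumBelow n (λ k → f k + g k) ≡ sumBelow n f + sumBelow n g
sumBelow-+ zero    f g = refl
sumBelow-+ (suc n) f g = begin
  sumBelow n (λ k → f k + g k) + (f n + g n)     ≡⟨ cong (_+ (f n + g n)) (sumBelow-+ n f g) ⟩
  sumBelow n f + sumBelow n g + (f n + g n)      ≡⟨ lemma (sumBelow n f) (sumBelow n g) (f n) (g n) ⟩
  sumBelow n f + f n + (sumBelow n g + g n)      ∎
  where
  lemma : ∀ a b c d → a + b + (c + d) ≡ a + c + (b + d)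
  lemma = solve-∀

sumBelow-shift : ∀ n f → f 0 ≡ + 0 → f n ≡ + 0 → sumBelow n f ≡ sumBelow n (λ k → f (suc k))
sumBelow-shift n f f0≡0 fn≡0 = begin
  sumBelow n f                            ≡⟨ +-identityʳ _ ⟨
  sumBelow n f + + 0                      ≡⟨ cong (λ x → sumBelow n f + x) fn≡0 ⟨
  sumBelow n f + f n                      ≡⟨ telescope n ⟩
  f 0 + sumBelow n (λ k → f (suc k))      ≡⟨ cong (_+ sumBelow n (λ k → f (suc k))) f0≡0 ⟩
  + 0 + sumBelow n (λ k → f (suc k))      ≡⟨ +-identityˡ _ ⟩
  sumBelow n (λ k → f (suc k))            ∎
  where
  -- Both boundary terms are carried through the induction, because `f` is known to vanish only at
  -- the final index.
  telescope : ∀ n → sumBelow n f + f n ≡ f 0 + sumBelow n (λ k → f (suc k))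
  telescope zero    = +-comm (+ 0) (f 0)
  telescope (suc n) = trans (cong (_+ f (suc n)) (telescope n)) (+-assoc (f 0) _ _)

∣-sumBelow : ∀ {d} n {f : ℕ → ℤ} → (∀ k → d Signed.∣ f k) → d Signed.∣ sumBelow n f
∣-sumBelow zero    d∣f = Signed.divides (+ 0) refl
∣-sumBelow (suc n) d∣f = Signed.∣m∣n⇒∣m+n (∣-sumBelow n d∣f) (d∣f n)

-- Binomial coefficients

binom : ℕ → ℕ → ℤ
binom n k = + (n C k)

central : ℕ → ℤ
central k = binom (2 ℕ.* k) k

pascal : ∀ n k → binom (suc n) (suc k) ≡ binom n k + binom n (suc k)
pascal n k = cong +_ (sym (nCk+nC[k+1]≡[n+1]C[k+1] n k))

absorption : ∀ n k → + suc k * binom (suc n) (suc k) ≡ + suc n * binom n k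
absorption n zero = begin
  + 1 * binom (suc n) 1  ≡⟨ cong (λ x → + 1 * + x) (nC1≡n (suc n)) ⟩
  + 1 * + suc n          ≡⟨ *-comm (+ 1) (+ suc n) ⟩
  + suc n * binom n 0    ∎
absorption zero (suc k) = *-zeroʳ (+ suc (suc k))
absorption (suc n) (suc k) = begin
  + suc (suc k) * binom (suc (suc n)) (suc (suc k))
    ≡⟨ cong (+ suc (suc k) *_) (pascal (suc n) (suc k)) ⟩
  (+ 1 + + suc k) * (c + d)
    -- Splitting off one copy of `c` lets both induction hypotheses apply; Pascal's rule then turns
    -- `a + b` back into `c`.
    ≡⟨ split (+ suc k) c d ⟩
  + suc k * c + c + + suc (suc k) * d
    ≡⟨ cong₂ (λ x y → x + c + y) (absorption n k) (absorption n (suc k)) ⟩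
  + suc n * a + c + + suc n * b
    ≡⟨ regroup (+ suc n) a b c ⟩
  c + + suc n * (a + b)
    ≡⟨ cong (λ x → c + + suc n * x) (pascal n k) ⟨
  c + + suc n * c
    ≡⟨ suc-* (+ suc n) c ⟨
  + suc (suc n) * c ∎
  where
  a b c d : ℤ
  a = binom n k
  b = binom n (suc k)
  c = binom (suc n) (suc k)
  d = binom (suc n) (suc (suc k))
  split : ∀ k c d → (+ 1 + k) * (c + d) ≡ k * c + c + (+ 1 + k) * d
  split = solve-∀
  regroup : ∀ n a b c → n * a + c + n * b ≡ c + n * (a + b)
  regroup = solve-∀

absorption-same : ∀ n k → + suc k * (binom n k + binom n (suc k)) ≡ + suc n * binom n k
absorption-same n k = trans (cong (+ suc k *_) (sym (pascal n k))) (absorption n k)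

binom-diagonal : ∀ n → binom n (suc n) ≡ + 0
binom-diagonal n = cong +_ (k>n⇒nCk≡0 (ℕ.n<1+n n))

-- Central binomial coefficients and Catalan numbers

odd : ℕ → ℤ
odd k = + 2 * + k + + 1

pos-2k : ∀ k → + (2 ℕ.* k) ≡ + 2 * + k
pos-2k k = pos-* 2 k

-- Two absorptions, joined by C(2k+1,k) = C(2k+1,k+1), lead from C(2k+2,k+1) to C(2k,k). Each uses
-- up a factor k+1, so an extra one is multiplied in and cancelled.
central-suc : ∀ k → + suc k * central (suc k) ≡ + 2 * odd k * central k
central-suc k = *-cancelˡ-≡ (+ suc k) _ _ (begin
  + suc k * (+ suc k * central (suc k))
    ≡⟨ cong (λ n → + suc k * (+ suc k * binom n (suc k))) (ℕ.*-suc 2 k) ⟩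
  + suc k * (+ suc k * binom (suc (suc (2 ℕ.* k))) (suc k))
    ≡⟨ cong (+ suc k *_) (absorption (suc (2 ℕ.* k)) k) ⟩
  + suc k * (+ suc (suc (2 ℕ.* k)) * binom (suc (2 ℕ.* k)) k)
    ≡⟨ cong (λ x → + suc k * (+ suc (suc (2 ℕ.* k)) * x)) symmetric ⟩
  + suc k * ((+ 2 + + (2 ℕ.* k)) * binom (suc (2 ℕ.* k)) (suc k))
    ≡⟨ swap (+ suc k) (+ 2 + + (2 ℕ.* k)) _ ⟩
  (+ 2 + + (2 ℕ.* k)) * (+ suc k * binom (suc (2 ℕ.* k)) (suc k))
    ≡⟨ cong ((+ 2 + + (2 ℕ.* k)) *_) (absorption (2 ℕ.* k) k) ⟩
  (+ 2 + + (2 ℕ.* k)) * ((+ 1 + + (2 ℕ.* k)) * central k)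
    ≡⟨ cong (λ x → (+ 2 + x) * ((+ 1 + x) * central k)) (pos-2k k) ⟩
  (+ 2 + + 2 * + k) * ((+ 1 + + 2 * + k) * central k)
    ≡⟨ regroup (+ k) (central k) ⟩
  + suc k * (+ 2 * odd k * central k) ∎)
  where
  symmetric : binom (suc (2 ℕ.* k)) k ≡ binom (suc (2 ℕ.* k)) (suc k)
  symmetric = cong +_ (trans (nCk≡nC[n∸k] k≤2k+1) (cong (suc (2 ℕ.* k) C_) 2k+1∸k≡k+1))
    where
    k≤2k+1 : k ℕ.≤ suc (2 ℕ.* k)
    k≤2k+1 = ℕ.≤-trans (ℕ.m≤m+n k _) (ℕ.n≤1+n _)
    2k+1∸k≡k+1 : suc (2 ℕ.* k) ℕ.∸ k ≡ suc k
    2k+1∸k≡k+1 = begin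
      suc (k ℕ.+ (k ℕ.+ 0)) ℕ.∸ k  ≡⟨ cong (ℕ._∸ k) (ℕ.+-suc k (k ℕ.+ 0)) ⟨
      (k ℕ.+ suc (k ℕ.+ 0)) ℕ.∸ k  ≡⟨ ℕ.m+n∸m≡n k _ ⟩
      suc (k ℕ.+ 0)                ≡⟨ cong suc (ℕ.+-identityʳ k) ⟩
      suc k                        ∎
  swap : ∀ a b c → a * (b * c) ≡ b * (a * c)
  swap = solve-∀
  regroup : ∀ k c → (+ 2 + + 2 * k) * ((+ 1 + + 2 * k) * c)
                  ≡ (+ 1 + k) * (+ 2 * (+ 2 * k + + 1) * c)
  regroup = solve-∀

-- Writing the Catalan number as a difference avoids division and makes it visibly an integer.
catalan : ℕ → ℤ
catalan k = central k + - binom (2 ℕ.* k) (suc k)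

-- Absorption in row 2k gives (k+1)(b+d) = (2k+1)b, that is (k+1)d = kb, so (k+1)(b-d) = b.
central≡[k+1]*catalan : ∀ k → central k ≡ + suc k * catalan k
central≡[k+1]*catalan k = begin
  b                                        ≡⟨ lemma (+ k) b d ⟩
  + suc k * (b + - d) + ((+ 1 + + k) * (b + d) + - ((+ 1 + + 2 * + k) * b))
    ≡⟨ cong (λ x → + suc k * (b + - d) + (+ suc k * (b + d) + - ((+ 1 + x) * b))) (pos-2k k) ⟨
  + suc k * (b + - d) + (+ suc k * (b + d) + - (+ suc (2 ℕ.* k) * b))
    ≡⟨ cong (λ x → + suc k * (b + - d) + x) (*-identityˡ _) ⟨
  + suc k * (b + - d) + + 1 * (+ suc k * (b + d) + - (+ suc (2 ℕ.* k) * b))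
    ≡⟨ absorb-multiple (+ 1) _ (absorption-same (2 ℕ.* k) k) ⟩
  + suc k * (b + - d)                      ∎
  where
  b d : ℤ
  b = central k
  d = binom (2 ℕ.* k) (suc k)
  lemma : ∀ k b d → b ≡ (+ 1 + k) * (b + - d) + ((+ 1 + k) * (b + d) + - ((+ 1 + + 2 * k) * b))
  lemma = solve-∀

-- The double sum for an arbitrary weight h

summand : ℕ → ℕ → ℤ
summand m k = binom m k * binom m k * central k * sign k

module Weighted (h : ℕ → ℤ) where

  weight : ℕ → ℤ
  weight k = + k * h k + + suc k * h (suc k)

  certificate : ℕ → ℕ → ℤ
  certificate n k =
    sign k * h (suc k) * odd k * central k * (binom n (suc k) * binom n (suc k))
      * (+ 3 * + suc k + - (+ 2 * + n))

  -- After a shift of `lower` by one index, it and `upper` both carry h(k+1), so `h` enters the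
  -- certificate identity only through one free variable.
  lower : ℕ → ℕ → ℤ
  lower m k = summand m k * odd k * (+ k * h k)

  upper : ℕ → ℕ → ℤ
  upper m k = summand m k * odd k * (+ suc k * h (suc k))

  certificate-suc : ∀ m k →
    certificate (suc m) k ≡ certificate m k + (lower m (suc k) + upper m k)
  certificate-suc m k = begin
    certificate (suc m) k
      ≡⟨ cong (λ c → sign k * h (suc k) * odd k * central k * (c * c)
                       * (+ 3 * + suc k + - (+ 2 * + suc m))) (pascal m k) ⟩
    sign k * h (suc k) * odd k * central k * ((a + b) * (a + b))
      * (+ 3 * + suc k + - (+ 2 * + suc m))
      -- The last two summands are multiples of the relations `central-suc` and `absorption-same`;
      -- their cofactors make this an exact polynomial identity.
      ≡⟨ lemma (sign k) (h (suc k)) (central k) (central (suc k)) a b (+ k) (+ m) ⟩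
    certificate m k + (lower m (suc k) + upper m k)
      + sign k * (b * b) * (+ 2 * + suc k + + 1) * h (suc k)
          * (+ suc k * central (suc k) + - (+ 2 * odd k * central k))
      + sign k * h (suc k) * odd k * central k * (+ 2 * a + + 4 * b)
          * (+ suc k * (a + b) + - (+ suc m * a))
      ≡⟨ absorb-multiple (sign k * h (suc k) * odd k * central k * (+ 2 * a + + 4 * b)) _
           (absorption-same m k) ⟩
    certificate m k + (lower m (suc k) + upper m k)
      + sign k * (b * b) * (+ 2 * + suc k + + 1) * h (suc k)
          * (+ suc k * central (suc k) + - (+ 2 * odd k * central k))
      ≡⟨ absorb-multiple (sign k * (b * b) * (+ 2 * + suc k + + 1) * h (suc k)) _
           (central-suc k) ⟩
    certificate m k + (lower m (suc k) + upper m k) ∎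
    where
    a b : ℤ
    a = binom m k
    b = binom m (suc k)
    lemma : ∀ s h c c′ a b k m →
      s * h * (+ 2 * k + + 1) * c * ((a + b) * (a + b)) * (+ 3 * (+ 1 + k) + - (+ 2 * (+ 1 + m)))
      ≡ s * h * (+ 2 * k + + 1) * c * (b * b) * (+ 3 * (+ 1 + k) + - (+ 2 * m))
        + (b * b * c′ * (- (+ 1) * s) * (+ 2 * (+ 1 + k) + + 1) * ((+ 1 + k) * h)
           + a * a * c * s * (+ 2 * k + + 1) * ((+ 1 + k) * h))
        + s * (b * b) * (+ 2 * (+ 1 + k) + + 1) * h
            * ((+ 1 + k) * c′ + - (+ 2 * (+ 2 * k + + 1) * c))
        + s * h * (+ 2 * k + + 1) * c * (+ 2 * a + + 4 * b)
            * ((+ 1 + k) * (a + b) + - ((+ 1 + m) * a))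
    lemma = solve-∀

  -- The term at 0 vanishes through its factor k, the term at m+1 through C(m,m+1) = 0.
  sum-lower-shift : ∀ m → sumBelow (suc m) (lower m) ≡ sumBelow (suc m) (λ k → lower m (suc k))
  sum-lower-shift m = sumBelow-shift (suc m) (lower m) (*-zeroʳ (summand m 0 * odd 0)) (begin
    lower m (suc m)
      ≡⟨ cong (λ b → b * b * central (suc m) * sign (suc m) * odd (suc m) * (+ suc m * h (suc m)))
           (binom-diagonal m) ⟩
    + 0 ∎)

  sum-summand : ∀ m → sumBelow (suc m) (λ k → summand m k * (odd k * weight k))
                    ≡ sumBelow (suc m) (λ k → lower m (suc k) + upper m k)
  sum-summand m = begin
    sumBelow (suc m) (λ k → summand m k * (odd k * weight k))
      ≡⟨ sumBelow-cong (suc m) (λ k → lemma (summand m k) (odd k) (+ k * h k) (+ suc k * h (suc k))) ⟩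
    sumBelow (suc m) (λ k → lower m k + upper m k)
      ≡⟨ sumBelow-+ (suc m) (lower m) (upper m) ⟩
    sumBelow (suc m) (lower m) + sumBelow (suc m) (upper m)
      ≡⟨ cong (_+ sumBelow (suc m) (upper m)) (sum-lower-shift m) ⟩
    sumBelow (suc m) (λ k → lower m (suc k)) + sumBelow (suc m) (upper m)
      ≡⟨ sumBelow-+ (suc m) (λ k → lower m (suc k)) (upper m) ⟨
    sumBelow (suc m) (λ k → lower m (suc k) + upper m k) ∎
    where
    lemma : ∀ t z x y → t * (z * (x + y)) ≡ t * z * x + t * z * y
    lemma = solve-∀

  -- This lets the range of the certificate sum grow by one term in the induction of `double-sum`.
  certificate-diagonal : ∀ m → certificate m m ≡ + 0
  certificate-diagonal m = begin
    certificate m m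
      ≡⟨ cong (λ b → sign m * h (suc m) * odd m * central m * (b * b)
                       * (+ 3 * + suc m + - (+ 2 * + m))) (binom-diagonal m) ⟩
    sign m * h (suc m) * odd m * central m * + 0 * (+ 3 * + suc m + - (+ 2 * + m))
      ≡⟨ cong (_* (+ 3 * + suc m + - (+ 2 * + m))) (*-zeroʳ (sign m * h (suc m) * odd m * central m)) ⟩
    + 0 ∎

  double-sum : ∀ n → sumBelow n (λ m → sumBelow (suc m) (λ k → summand m k * (odd k * weight k)))
                   ≡ sumBelow n (certificate n)
  double-sum zero    = refl
  double-sum (suc n) = begin
    sumBelow n (λ m → sumBelow (suc m) (λ k → summand m k * (odd k * weight k)))
      + sumBelow (suc n) (λ k → summand n k * (odd k * weight k))
      ≡⟨ cong₂ _+_ (double-sum n) (sum-summand n) ⟩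
    sumBelow n (certificate n) + increment
      ≡⟨ cong (_+ increment) (+-identityʳ (sumBelow n (certificate n))) ⟨
    sumBelow n (certificate n) + + 0 + increment
      ≡⟨ cong (λ x → sumBelow n (certificate n) + x + increment) (certificate-diagonal n) ⟨
    sumBelow (suc n) (certificate n) + increment
      ≡⟨ sumBelow-+ (suc n) (certificate n) (λ k → lower n (suc k) + upper n k) ⟨
    sumBelow (suc n) (λ k → certificate n k + (lower n (suc k) + upper n k))
      ≡⟨ sumBelow-cong (suc n) (certificate-suc n) ⟨
    sumBelow (suc n) (certificate (suc n)) ∎
    where
    increment : ℤ
    increment = sumBelow (suc n) (λ k → lower n (suc k) + upper n k)

  -- The central coefficient supplies a factor k+1. With N = n+1 and (k+1)c = Np, (k+1)c²(3(k+1) -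
  -- 2N) = 3((k+1)c)² - 2Nc(k+1)c = N²(3p² - 2pc).
  n²∣certificate : ∀ n k → + suc n * + suc n Signed.∣ certificate (suc n) k
  n²∣certificate n k = Signed.divides (s * catalan k * (+ 3 * (p * p) + - (+ 2 * (p * c)))) (begin
    s * central k * (c * c) * v
      ≡⟨ cong (λ x → s * x * (c * c) * v) (central≡[k+1]*catalan k) ⟩
    s * (+ suc k * catalan k) * (c * c) * v
      ≡⟨ lemma s (catalan k) c p (+ suc k) (+ suc n) ⟩
    s * catalan k * (+ 3 * (p * p) + - (+ 2 * (p * c))) * (+ suc n * + suc n)
      + s * catalan k * (+ 3 * (+ suc k * c + + suc n * p) + - (+ 2 * (+ suc n * c)))
          * (+ suc k * c + - (+ suc n * p))
      ≡⟨ absorb-multiple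
           (s * catalan k * (+ 3 * (+ suc k * c + + suc n * p) + - (+ 2 * (+ suc n * c)))) _
           (absorption n k) ⟩
    s * catalan k * (+ 3 * (p * p) + - (+ 2 * (p * c))) * (+ suc n * + suc n) ∎)
    where
    s c p v : ℤ
    s = sign k * h (suc k) * odd k
    c = binom (suc n) (suc k)
    p = binom n k
    v = + 3 * + suc k + - (+ 2 * + suc n)
    lemma : ∀ s q c p k n →
      s * (k * q) * (c * c) * (+ 3 * k + - (+ 2 * n))
      ≡ s * q * (+ 3 * (p * p) + - (+ 2 * (p * c))) * (n * n)
        + s * q * (+ 3 * (k * c + n * p) + - (+ 2 * (n * c))) * (k * c + - (n * p))
    lemma = solve-∀

  n²∣double-sum : ∀ n →
    + n * + n Signed.∣ sumBelow n (λ m → sumBelow (suc m) (λ k → summand m k * (odd k * weight k)))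
  n²∣double-sum zero    = Signed.divides (+ 0) refl
  n²∣double-sum (suc n) = subst (_ Signed.∣_) (sym (double-sum (suc n)))
                            (∣-sumBelow (suc n) (n²∣certificate n))

open Weighted using (weight; n²∣double-sum)

-- Odd powers of 2k+1 as weights

Representable : (ℕ → ℤ) → Set
Representable f = ∃ λ h → ∀ k → f k ≡ weight h k

-- This is the product of the 2i consecutive integers from k-i+1 to k+i.
e : ℕ → ℕ → ℤ
e zero    k = + 1
e (suc i) k = e i k * ((+ k + + suc i) * (+ k + - (+ i)))

∏[k²-j²] : ℕ → ℤ → ℤ
∏[k²-j²] zero    x = + 1
∏[k²-j²] (suc i) x = ∏[k²-j²] i x * ((x + + suc i) * (x + - (+ suc i)))

-- The left side is the product of the integers from k-i to k+i; the smallest is split off.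
k*∏[k²-j²] : ∀ i k → + k * ∏[k²-j²] i (+ k) ≡ (+ k + - (+ i)) * e i k
k*∏[k²-j²] zero    k = cong (_* + 1) (sym (+-identityʳ (+ k)))
k*∏[k²-j²] (suc i) k = begin
  + k * (∏[k²-j²] i (+ k) * w)
    ≡⟨ *-assoc (+ k) _ w ⟨
  + k * ∏[k²-j²] i (+ k) * w         ≡⟨ cong (_* w) (k*∏[k²-j²] i k) ⟩
  (+ k + - (+ i)) * e i k * w        ≡⟨ lemma (+ k) (+ i) (e i k) ⟩
  (+ k + - (+ suc i)) * e (suc i) k  ∎
  where
  w : ℤ
  w = (+ k + + suc i) * (+ k + - (+ suc i))
  lemma : ∀ k i x → (k + - i) * x * ((k + (+ 1 + i)) * (k + - (+ 1 + i)))
                  ≡ (k + - (+ 1 + i)) * (x * ((k + (+ 1 + i)) * (k + - i)))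
  lemma = solve-∀

-- Here the integers run from k+1-i to k+1+i, and the largest is split off.
[k+1]*∏[k²-j²] : ∀ i k → + suc k * ∏[k²-j²] i (+ suc k) ≡ (+ suc k + + i) * e i k
[k+1]*∏[k²-j²] zero    k = cong (_* + 1) (sym (+-identityʳ (+ suc k)))
[k+1]*∏[k²-j²] (suc i) k = begin
  + suc k * (∏[k²-j²] i (+ suc k) * w)  ≡⟨ *-assoc (+ suc k) (∏[k²-j²] i (+ suc k)) w ⟨
  + suc k * ∏[k²-j²] i (+ suc k) * w    ≡⟨ cong (_* w) ([k+1]*∏[k²-j²] i k) ⟩
  (+ suc k + + i) * e i k * w           ≡⟨ lemma (+ k) (+ i) (e i k) ⟩
  (+ suc k + + suc i) * e (suc i) k     ∎
  where
  w : ℤ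
  w = (+ suc k + + suc i) * (+ suc k + - (+ suc i))
  lemma : ∀ k i x → (+ 1 + k + i) * x * ((+ 1 + k + (+ 1 + i)) * (+ 1 + k + - (+ 1 + i)))
                  ≡ (+ 1 + k + (+ 1 + i)) * (x * ((k + (+ 1 + i)) * (k + - i)))
  lemma = solve-∀

-- The two split-off factors k-i and k+1+i add up to 2k+1.
e-representable : ∀ i → Representable (λ k → odd k * e i k)
e-representable i = (λ k → ∏[k²-j²] i (+ k)) , λ k → begin
  odd k * e i k
    ≡⟨ lemma (+ k) (+ i) (e i k) ⟩
  (+ k + - (+ i)) * e i k + (+ suc k + + i) * e i k
    ≡⟨ cong₂ _+_ (k*∏[k²-j²] i k) ([k+1]*∏[k²-j²] i k) ⟨
  + k * ∏[k²-j²] i (+ k) + + suc k * ∏[k²-j²] i (+ suc k) ∎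
  where
  lemma : ∀ k i x → (+ 2 * k + + 1) * x ≡ (k + - i) * x + (+ 1 + k + i) * x
  lemma = solve-∀

-- Since (2k+1)² - (2i+1)² = 4(k-i)(k+i+1), a factor (2k+1)² turns `e i` into a combination of
-- `e (suc i)` and `e i` with coefficients free of k. Hence the induction on r keeps i general.
even-power*e-representable : ∀ r i →
  Representable (λ k → (odd k * odd k) ^ r * (odd k * e i k))
even-power*e-representable zero    i with e-representable i
... | h , h-rep = h , λ k → trans (*-identityˡ (odd k * e i k)) (h-rep k)
even-power*e-representable (suc r) i
  with even-power*e-representable r (suc i) | even-power*e-representable r i
... | f , f-rep | g , g-rep = (λ k → + 4 * f k + odd i * odd i * g k) , λ k → begin
  odd k * odd k * (odd k * odd k) ^ r * (odd k * e i k)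
    ≡⟨ expand (+ k) (+ i) ((odd k * odd k) ^ r) (e i k) ⟩
  + 4 * ((odd k * odd k) ^ r * (odd k * e (suc i) k))
    + odd i * odd i * ((odd k * odd k) ^ r * (odd k * e i k))
    ≡⟨ cong₂ (λ x y → + 4 * x + odd i * odd i * y) (f-rep k) (g-rep k) ⟩
  + 4 * (+ k * f k + + suc k * f (suc k)) + odd i * odd i * (+ k * g k + + suc k * g (suc k))
    ≡⟨ regroup (odd i * odd i) (+ k) (+ suc k) (f k) (f (suc k)) (g k) (g (suc k)) ⟩
  + k * (+ 4 * f k + odd i * odd i * g k) + + suc k * (+ 4 * f (suc k) + odd i * odd i * g (suc k)) ∎
  where
  expand : ∀ k i y x →
    (+ 2 * k + + 1) * (+ 2 * k + + 1) * y * ((+ 2 * k + + 1) * x)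
    ≡ + 4 * (y * ((+ 2 * k + + 1) * (x * ((k + (+ 1 + i)) * (k + - i)))))
      + (+ 2 * i + + 1) * (+ 2 * i + + 1) * (y * ((+ 2 * k + + 1) * x))
  expand = solve-∀
  regroup : ∀ c k k′ f f′ g g′ →
    + 4 * (k * f + k′ * f′) + c * (k * g + k′ * g′)
    ≡ k * (+ 4 * f + c * g) + k′ * (+ 4 * f′ + c * g′)
  regroup = solve-∀

-- Rewriting T and concluding the divisibility

T≡sum-summand : ∀ m s → T m s ≡ sumBelow (suc m) (λ k → summand m k * odd k ^ s)
T≡sum-summand m s = trans (sumTo≡sumBelow m _) (sumBelow-cong (suc m) term)
  where
  pos-odd : ∀ k → + (2 ℕ.* k ℕ.+ 1) ≡ odd k
  pos-odd k = cong (_+ + 1) (pos-2k k)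
  lemma : ∀ a b z s → a * (a * + 1) * b * z * s ≡ a * a * b * s * z
  lemma = solve-∀
  term : ∀ k → + ((m C k) ℕ.^ 2 ℕ.* ((2 ℕ.* k) C k) ℕ.* (2 ℕ.* k ℕ.+ 1) ℕ.^ s) * sign k
             ≡ summand m k * odd k ^ s
  term k = begin
    + ((m C k) ℕ.^ 2 ℕ.* ((2 ℕ.* k) C k) ℕ.* (2 ℕ.* k ℕ.+ 1) ℕ.^ s) * sign k
      ≡⟨ cong (_* sign k) (pos-* ((m C k) ℕ.^ 2 ℕ.* ((2 ℕ.* k) C k)) _) ⟩
    + ((m C k) ℕ.^ 2 ℕ.* ((2 ℕ.* k) C k)) * + ((2 ℕ.* k ℕ.+ 1) ℕ.^ s) * sign k
      ≡⟨ cong₂ (λ x y → x * y * sign k)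
           (trans (pos-* ((m C k) ℕ.^ 2) _) (cong (_* central k) (pos-^ (m C k) 2)))
           (trans (pos-^ (2 ℕ.* k ℕ.+ 1) s) (cong (_^ s) (pos-odd k))) ⟩
    binom m k * (binom m k * + 1) * central k * odd k ^ s * sign k
      ≡⟨ lemma (binom m k) (central k) (odd k ^ s) (sign k) ⟩
    summand m k * odd k ^ s ∎

-- The final `+ 1` stands for `e 0 k`, so the right side matches the represented function at i = 0.
even-power : ∀ z r → z ^ (2 ℕ.* suc r) ≡ z * ((z * z) ^ r * (z * + 1))
even-power z r = begin
  z ^ (2 ℕ.* suc r)            ≡⟨ ^-*-assoc z 2 (suc r) ⟨
  (z * (z * + 1)) ^ suc r      ≡⟨ cong (λ x → (z * x) ^ suc r) (*-identityʳ z) ⟩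
  z * z * (z * z) ^ r          ≡⟨ lemma z ((z * z) ^ r) ⟩
  z * ((z * z) ^ r * (z * + 1)) ∎
  where
  lemma : ∀ z y → z * z * y ≡ z * (y * (z * + 1))
  lemma = solve-∀

theorem1p2 : (n r : ℕ) → NonZero n → NonZero r →
    (+ (n ℕ.^ 2)) ∣ sumBelow n (λ k → T k (2 ℕ.* r))
-- The double sum already contains one factor 2k+1; of the exponent 2(r+1), the odd power 2r+1 is
-- left for the weight.
theorem1p2 n (suc r) _ _ with even-power*e-representable r 0
... | h , h-rep = Signed.∣⇒∣ᵤ (subst₂ Signed._∣_ n*n≡n² double-sum≡ (n²∣double-sum h n))
  where
  n*n≡n² : + n * + n ≡ + (n ℕ.^ 2)
  n*n≡n² = trans (sym (pos-* n n)) (cong (λ x → + (n ℕ.* x)) (sym (ℕ.*-identityʳ n)))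
  odd*weight : ∀ k → odd k * weight h k ≡ odd k ^ (2 ℕ.* suc r)
  odd*weight k = trans (cong (odd k *_) (sym (h-rep k))) (sym (even-power (odd k) r))
  double-sum≡ : sumBelow n (λ m → sumBelow (suc m) (λ k → summand m k * (odd k * weight h k)))
              ≡ sumBelow n (λ m → T m (2 ℕ.* suc r))
  double-sum≡ = sumBelow-cong n λ m → trans
    (sumBelow-cong (suc m) λ k → cong (summand m k *_) (odd*weight k))
    (sym (T≡sum-summand m (2 ℕ.* suc r)))
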